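{- Let $b$ be a fixed integer. Then the elements of $I_{b,c}^{3,tr}$ are distributed almost uniformly in the unit interval for sufficiently large negative $c$ (i.e. for integers $c$ with $c<0$ and $|c|$ sufficiently large).
   Context: For integers $m, n$ satisfying $n \le -m-3$, define $$I_{m,n}^{3,tr} := \{\alpha \in (0,1) \mid \alpha^3+m\alpha^2+n\alpha+d=0 \text{ for some } d \in \mathbb{Z},\ 1 \le d \le -m-n-2\}.$$ Almost uniformity: let $S_1, S_2, \dots$ be a family of finite sets in $[0,1]$, where $S_N$ has $N$ elements $x_1 < x_2 < \dots < x_N$, and put $\Delta_i := x_{i+1}-x_i$ for $i \in \{1,\dots,N-1\}$. Suppose there is a constant $C$ independent of $N$ such that $\max_{1 \le i \le N-1} \left|\Delta_i - \frac{1}{N}\right| \le \frac{C}{N^2}$ for all $N$. Then the elements of $S_N$ are said to be distributed almost uniformly in the unit interval if $N \ge 2C$; without specifying $C$, one says that the elements of $S_N$ are distributed almost uniformly in the unit interval for sufficiently large $N$. Thus the assertion "almost uniformly for sufficiently large $N$" means that such a constant $C$ exists. Here, for fixed $b$, the family is indexed by the number of elements $N = -b-c-2$ of $I_{b,c}^{3,tr}$, i.e. $S_N = I_{b,\,-b-2-N}^{3,tr}$ for $N = 1,2,\dots$; the constant $C$ may depend on $b$. -}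

module Defs where

open import Data.Fin.Base as Fin using (Fin; toℕ)
open import Data.Integer.Base as ℤ using (ℤ; +_; 1ℤ)
open import Data.Nat.Base as ℕ using (ℕ; zero; suc; _⊔_)
import Data.Nat.Properties as ℕ
open import Data.Product.Base using (∃-syntax; _×_; _,_; proj₁; proj₂)
open import Data.Rational.Base as ℚ using (ℚ; 0ℚ; 1ℚ; ½)
import Data.Rational.Properties as ℚ
open import Data.Rational.Solver using (module +-*-Solver)
open import Data.Sum.Base using (inj₁; inj₂)
open import Level using (0ℓ)
open import Relation.Binary.PropositionalEquality
open import Relation.Unary using (Pred)

-- Real numbers, as Cauchy sequences of rationals. Arithmetic is
-- termwise; the equality of reals is _≈_, not _≡_.

Eventually : Pred ℕ 0ℓ → Set
Eventually P = ∃[ M ] ∀ n → M ℕ.≤ n → P n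

IsCauchy : (ℕ → ℚ) → Set
IsCauchy x = ∀ ε → 0ℚ ℚ.< ε →
  ∃[ M ] ∀ m n → M ℕ.≤ m → M ℕ.≤ n → ℚ.∣ x m ℚ.- x n ∣ ℚ.< ε

record ℝ : Set where
  constructor mkℝ
  field
    seq    : ℕ → ℚ
    cauchy : IsCauchy seq

open ℝ public

abstract

  ½-pos : ∀ ε → 0ℚ ℚ.< ε → 0ℚ ℚ.< ½ ℚ.* ε
  ½-pos ε 0<ε = subst (ℚ._< ½ ℚ.* ε) (ℚ.*-zeroʳ ½) (ℚ.*-monoʳ-<-pos ½ 0<ε)

  ½+½ : ∀ ε → ½ ℚ.* ε ℚ.+ ½ ℚ.* ε ≡ ε
  ½+½ ε = trans (sym (ℚ.*-distribʳ-+ ε ½ ½)) (ℚ.*-identityˡ ε)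

  +-cauchy : ∀ x y → IsCauchy x → IsCauchy y → IsCauchy (λ n → x n ℚ.+ y n)
  +-cauchy x y cx cy ε 0<ε with cx (½ ℚ.* ε) (½-pos ε 0<ε) | cy (½ ℚ.* ε) (½-pos ε 0<ε)
  ... | M₁ , p | M₂ , q = M₁ ⊔ M₂ , λ m n M≤m M≤n → begin-strict
    ℚ.∣ (x m ℚ.+ y m) ℚ.- (x n ℚ.+ y n) ∣
      ≡⟨ cong ℚ.∣_∣ (solve 4 (λ a b c d → (a :+ b) :- (c :+ d) := (a :- c) :+ (b :- d))
           refl (x m) (y m) (x n) (y n)) ⟩
    ℚ.∣ (x m ℚ.- x n) ℚ.+ (y m ℚ.- y n) ∣
      ≤⟨ ℚ.∣p+q∣≤∣p∣+∣q∣ (x m ℚ.- x n) (y m ℚ.- y n) ⟩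
    ℚ.∣ x m ℚ.- x n ∣ ℚ.+ ℚ.∣ y m ℚ.- y n ∣
      <⟨ ℚ.+-mono-< (p m n (ℕ.m⊔n≤o⇒m≤o M₁ M₂ M≤m) (ℕ.m⊔n≤o⇒m≤o M₁ M₂ M≤n))
                    (q m n (ℕ.m⊔n≤o⇒n≤o M₁ M₂ M≤m) (ℕ.m⊔n≤o⇒n≤o M₁ M₂ M≤n)) ⟩
    ½ ℚ.* ε ℚ.+ ½ ℚ.* ε
      ≡⟨ ½+½ ε ⟩
    ε ∎
    where
    open ℚ.≤-Reasoning
    open +-*-Solver

  neg-cauchy : ∀ x → IsCauchy x → IsCauchy (λ n → ℚ.- x n)
  neg-cauchy x cx ε 0<ε with cx ε 0<ε
  ... | M , p = M , λ m n M≤m M≤n → subst (ℚ._< ε)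
    (trans (sym (ℚ.∣-p∣≡∣p∣ (x m ℚ.- x n))) (cong ℚ.∣_∣ (ℚ.neg-distrib-+ (x m) (ℚ.- x n))))
    (p m n M≤m M≤n)

  ∣p∣-∣q∣≤∣p-q∣ : ∀ p q → ℚ.∣ p ∣ ℚ.- ℚ.∣ q ∣ ℚ.≤ ℚ.∣ p ℚ.- q ∣
  ∣p∣-∣q∣≤∣p-q∣ p q = begin
    ℚ.∣ p ∣ ℚ.- ℚ.∣ q ∣
      ≡⟨ cong (λ r → ℚ.∣ r ∣ ℚ.- ℚ.∣ q ∣) (solve 2 (λ a b → a := (a :- b) :+ b) refl p q) ⟩
    ℚ.∣ (p ℚ.- q) ℚ.+ q ∣ ℚ.- ℚ.∣ q ∣
      ≤⟨ ℚ.+-monoˡ-≤ (ℚ.- ℚ.∣ q ∣) (ℚ.∣p+q∣≤∣p∣+∣q∣ (p ℚ.- q) q) ⟩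
    (ℚ.∣ p ℚ.- q ∣ ℚ.+ ℚ.∣ q ∣) ℚ.- ℚ.∣ q ∣
      ≡⟨ solve 2 (λ a b → (a :+ b) :- b := a) refl ℚ.∣ p ℚ.- q ∣ ℚ.∣ q ∣ ⟩
    ℚ.∣ p ℚ.- q ∣ ∎
    where
    open ℚ.≤-Reasoning
    open +-*-Solver

  ∣-∣-cauchy : ∀ x → IsCauchy x → IsCauchy (λ n → ℚ.∣ x n ∣)
  ∣-∣-cauchy x cx ε 0<ε with cx ε 0<ε
  ... | M , p = M , bound
    where
    bound : ∀ m n → M ℕ.≤ m → M ℕ.≤ n → ℚ.∣ ℚ.∣ x m ∣ ℚ.- ℚ.∣ x n ∣ ∣ ℚ.< ε
    bound m n M≤m M≤n with ℚ.∣p∣≡p∨∣p∣≡-p (ℚ.∣ x m ∣ ℚ.- ℚ.∣ x n ∣)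
    ... | inj₁ e = subst (ℚ._< ε) (sym e)
      (ℚ.≤-<-trans (∣p∣-∣q∣≤∣p-q∣ (x m) (x n)) (p m n M≤m M≤n))
    ... | inj₂ e = subst (ℚ._< ε)
      (sym (trans e (solve 2 (λ a b → :- (a :- b) := b :- a) refl ℚ.∣ x m ∣ ℚ.∣ x n ∣)))
      (ℚ.≤-<-trans (∣p∣-∣q∣≤∣p-q∣ (x n) (x m)) (p n m M≤n M≤m))
      where open +-*-Solver

  tailBound : ∀ x → IsCauchy x → ∃[ B ] 0ℚ ℚ.< B × Eventually (λ n → ℚ.∣ x n ∣ ℚ.≤ B)
  tailBound x cx with cx 1ℚ (ℚ.positive⁻¹ 1ℚ)
  ... | M , p = 1ℚ ℚ.+ ℚ.∣ x M ∣
              , ℚ.+-mono-<-≤ {0ℚ} {1ℚ} (ℚ.positive⁻¹ 1ℚ) (ℚ.0≤∣p∣ (x M))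
              , M , λ n M≤n → begin
    ℚ.∣ x n ∣
      ≡⟨ cong ℚ.∣_∣ (solve 2 (λ a b → a := (a :- b) :+ b) refl (x n) (x M)) ⟩
    ℚ.∣ (x n ℚ.- x M) ℚ.+ x M ∣
      ≤⟨ ℚ.∣p+q∣≤∣p∣+∣q∣ (x n ℚ.- x M) (x M) ⟩
    ℚ.∣ x n ℚ.- x M ∣ ℚ.+ ℚ.∣ x M ∣
      ≤⟨ ℚ.+-monoˡ-≤ ℚ.∣ x M ∣ (ℚ.<⇒≤ (p n M M≤n ℕ.≤-refl)) ⟩
    1ℚ ℚ.+ ℚ.∣ x M ∣ ∎
    where
    open ℚ.≤-Reasoning
    open +-*-Solver

  scaled-cauchy : ∀ x → IsCauchy x → ∀ B → 0ℚ ℚ.< B → ∀ ε → 0ℚ ℚ.< ε →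
    ∃[ M ] ∀ m n → M ℕ.≤ m → M ℕ.≤ n → B ℚ.* ℚ.∣ x m ℚ.- x n ∣ ℚ.< ε
  scaled-cauchy x cx B 0<B ε 0<ε = M , λ m n M≤m M≤n →
      subst (B ℚ.* ℚ.∣ x m ℚ.- x n ∣ ℚ.<_) B*δ≡ε (ℚ.*-monoʳ-<-pos B (p m n M≤m M≤n))
    where
    instance
      B-pos : ℚ.Positive B
      B-pos = ℚ.positive 0<B
      B-nz : ℚ.NonZero B
      B-nz = ℚ.pos⇒nonZero B
      ε-pos : ℚ.Positive ε
      ε-pos = ℚ.positive 0<ε
      B⁻¹-pos : ℚ.Positive (ℚ.1/ B)
      B⁻¹-pos = ℚ.1/pos⇒pos B
    δ : ℚ
    δ = (ℚ.1/ B) ℚ.* ε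
    B*δ≡ε : B ℚ.* δ ≡ ε
    B*δ≡ε = trans (sym (ℚ.*-assoc B (ℚ.1/ B) ε))
           (trans (cong (ℚ._* ε) (ℚ.*-inverseʳ B)) (ℚ.*-identityˡ ε))
    found : ∃[ M ] ∀ m n → M ℕ.≤ m → M ℕ.≤ n → ℚ.∣ x m ℚ.- x n ∣ ℚ.< δ
    found = cx δ (ℚ.positive⁻¹ δ {{ℚ.pos*pos⇒pos (ℚ.1/ B) ε}})
    M : ℕ
    M = proj₁ found
    p : ∀ m n → M ℕ.≤ m → M ℕ.≤ n → ℚ.∣ x m ℚ.- x n ∣ ℚ.< δ
    p = proj₂ found

  product-gap : ∀ A B a b c d → ℚ.∣ a ∣ ℚ.≤ A → ℚ.∣ d ∣ ℚ.≤ B →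
    ℚ.∣ a ℚ.* b ℚ.- c ℚ.* d ∣ ℚ.≤ A ℚ.* ℚ.∣ b ℚ.- d ∣ ℚ.+ B ℚ.* ℚ.∣ a ℚ.- c ∣
  product-gap A B a b c d ∣a∣≤A ∣d∣≤B = begin
    ℚ.∣ a ℚ.* b ℚ.- c ℚ.* d ∣
      ≡⟨ cong ℚ.∣_∣ (solve 4 (λ a b c d → a :* b :- c :* d := a :* (b :- d) :+ d :* (a :- c))
           refl a b c d) ⟩
    ℚ.∣ a ℚ.* (b ℚ.- d) ℚ.+ d ℚ.* (a ℚ.- c) ∣
      ≤⟨ ℚ.∣p+q∣≤∣p∣+∣q∣ (a ℚ.* (b ℚ.- d)) (d ℚ.* (a ℚ.- c)) ⟩
    ℚ.∣ a ℚ.* (b ℚ.- d) ∣ ℚ.+ ℚ.∣ d ℚ.* (a ℚ.- c) ∣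
      ≡⟨ cong₂ ℚ._+_ (ℚ.∣p*q∣≡∣p∣*∣q∣ a (b ℚ.- d)) (ℚ.∣p*q∣≡∣p∣*∣q∣ d (a ℚ.- c)) ⟩
    ℚ.∣ a ∣ ℚ.* ℚ.∣ b ℚ.- d ∣ ℚ.+ ℚ.∣ d ∣ ℚ.* ℚ.∣ a ℚ.- c ∣
      ≤⟨ ℚ.+-mono-≤
           (ℚ.*-monoʳ-≤-nonNeg ℚ.∣ b ℚ.- d ∣ {{ℚ.∣-∣-nonNeg (b ℚ.- d)}} ∣a∣≤A)
           (ℚ.*-monoʳ-≤-nonNeg ℚ.∣ a ℚ.- c ∣ {{ℚ.∣-∣-nonNeg (a ℚ.- c)}} ∣d∣≤B) ⟩
    A ℚ.* ℚ.∣ b ℚ.- d ∣ ℚ.+ B ℚ.* ℚ.∣ a ℚ.- c ∣ ∎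
    where
    open ℚ.≤-Reasoning
    open +-*-Solver

  *-cauchy : ∀ x y → IsCauchy x → IsCauchy y → IsCauchy (λ n → x n ℚ.* y n)
  *-cauchy x y cx cy ε 0<ε =
    let A , 0<A , M₁ , a = tailBound x cx
        B , 0<B , M₂ , b = tailBound y cy
        M₃ , p = scaled-cauchy y cy A 0<A (½ ℚ.* ε) (½-pos ε 0<ε)
        M₄ , q = scaled-cauchy x cx B 0<B (½ ℚ.* ε) (½-pos ε 0<ε)
        M₁₂ = M₁ ⊔ M₂
        M₃₄ = M₃ ⊔ M₄
    in M₁₂ ⊔ M₃₄ , λ m n M≤m M≤n →
      let m₁₂ = ℕ.m⊔n≤o⇒m≤o M₁₂ M₃₄ M≤m
          n₁₂ = ℕ.m⊔n≤o⇒m≤o M₁₂ M₃₄ M≤n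
          m₃₄ = ℕ.m⊔n≤o⇒n≤o M₁₂ M₃₄ M≤m
          n₃₄ = ℕ.m⊔n≤o⇒n≤o M₁₂ M₃₄ M≤n
      in ℚ.≤-<-trans
        (product-gap A B (x m) (y m) (x n) (y n)
          (a m (ℕ.m⊔n≤o⇒m≤o M₁ M₂ m₁₂)) (b n (ℕ.m⊔n≤o⇒n≤o M₁ M₂ n₁₂)))
        (subst (A ℚ.* ℚ.∣ y m ℚ.- y n ∣ ℚ.+ B ℚ.* ℚ.∣ x m ℚ.- x n ∣ ℚ.<_) (½+½ ε)
          (ℚ.+-mono-<
            (p m n (ℕ.m⊔n≤o⇒m≤o M₃ M₄ m₃₄) (ℕ.m⊔n≤o⇒m≤o M₃ M₄ n₃₄))
            (q m n (ℕ.m⊔n≤o⇒n≤o M₃ M₄ m₃₄) (ℕ.m⊔n≤o⇒n≤o M₃ M₄ n₃₄))))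

  const-cauchy : ∀ q → IsCauchy (λ _ → q)
  const-cauchy q ε 0<ε = 0 , λ _ _ _ _ →
    subst (ℚ._< ε) (sym (cong ℚ.∣_∣ (ℚ.+-inverseʳ q))) 0<ε

infix  4 _≈_ _<_ _≤_
infixl 6 _+_ _-_
infixl 7 _*_
infixr 8 _^_
infix  8 -_ 1/_

_≈_ : ℝ → ℝ → Set
x ≈ y = ∀ ε → 0ℚ ℚ.< ε → Eventually λ n → ℚ.∣ seq x n ℚ.- seq y n ∣ ℚ.< ε

_≤_ : ℝ → ℝ → Set
x ≤ y = ∀ ε → 0ℚ ℚ.< ε → Eventually λ n → seq x n ℚ.< seq y n ℚ.+ ε

_<_ : ℝ → ℝ → Set
x < y = ∃[ ε ] 0ℚ ℚ.< ε × Eventually λ n → seq x n ℚ.+ ε ℚ.< seq y n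

fromℚ : ℚ → ℝ
fromℚ q = mkℝ (λ _ → q) (const-cauchy q)

fromℤ : ℤ → ℝ
fromℤ z = fromℚ (z ℚ./ 1)

0ℝ 1ℝ : ℝ
0ℝ = fromℚ 0ℚ
1ℝ = fromℚ 1ℚ

1/_ : (N : ℕ) .{{_ : ℕ.NonZero N}} → ℝ
1/ N = fromℚ (1ℤ ℚ./ N)

_+_ : ℝ → ℝ → ℝ
x + y = mkℝ (λ n → seq x n ℚ.+ seq y n) (+-cauchy (seq x) (seq y) (cauchy x) (cauchy y))

-_ : ℝ → ℝ
- x = mkℝ (λ n → ℚ.- seq x n) (neg-cauchy (seq x) (cauchy x))

_-_ : ℝ → ℝ → ℝ
x - y = x + (- y)

_*_ : ℝ → ℝ → ℝ
x * y = mkℝ (λ n → seq x n ℚ.* seq y n) (*-cauchy (seq x) (seq y) (cauchy x) (cauchy y))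

_^_ : ℝ → ℕ → ℝ
x ^ zero  = 1ℝ
x ^ suc n = x * x ^ n

∣_∣ : ℝ → ℝ
∣ x ∣ = mkℝ (λ n → ℚ.∣ seq x n ∣) (∣-∣-cauchy (seq x) (cauchy x))

-- S has exactly N elements (up to _≈_), namely x₀ < x₁ < ... < x_{N-1}.
record IsIncreasingEnumeration (S : Pred ℝ 0ℓ) {N : ℕ} (x : Fin N → ℝ) : Set where
  field
    member     : ∀ i → S (x i)
    increasing : ∀ i j → i Fin.< j → x i < x j
    exhaustive : ∀ α → S α → ∃[ i ] α ≈ x i

-- max |Δᵢ - 1/N| ≤ C/N², where Δᵢ is the gap between consecutive points.
GapBound : ℝ → (N : ℕ) .{{_ : ℕ.NonZero N}} → (Fin N → ℝ) → Set
GapBound C N x = ∀ i j → toℕ j ≡ suc (toℕ i) →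
  ∣ (x j - x i) - 1/ N ∣ ≤ C * (1/ N) ^ 2

-- The family S₁, S₂, ... of finite sets in [0,1], with S_N of size N, is
-- distributed almost uniformly for sufficiently large N; the value of
-- the family at N = 0 plays no role. An increasing enumeration is unique
-- up to _≈_, so it does not matter that it is quantified existentially.
record AlmostUniformForLargeN (S : ℕ → Pred ℝ 0ℓ) : Set where
  field
    inUnitInterval : ∀ N .{{_ : ℕ.NonZero N}} α → S N α → 0ℝ ≤ α × α ≤ 1ℝ
    almostUniform  : ∃[ C ] ∀ N .{{_ : ℕ.NonZero N}} →
      ∃[ x ] IsIncreasingEnumeration (S N) {N} x × GapBound C N x

-- Of interest for n ≤ - m - 3; otherwise no d is admissible and the set
-- is empty.
I³ᵗʳ : ℤ → ℤ → Pred ℝ 0ℓ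
I³ᵗʳ m n α = 0ℝ < α × α < 1ℝ ×
  ∃[ d ] 1ℤ ℤ.≤ d × d ℤ.≤ ℤ.- m ℤ.- n ℤ.- + 2 ×
         α ^ 3 + fromℤ m * α ^ 2 + fromℤ n * α + fromℤ d ≈ 0ℝ

-- For fixed b, the sets I³ᵗʳ b c indexed by N = - b - c - 2.
I³ᵗʳ-family : ℤ → ℕ → Pred ℝ 0ℓ
I³ᵗʳ-family b N = I³ᵗʳ b (ℤ.- b ℤ.- + 2 ℤ.- + N)

{-# OPTIONS --safe #-}

-- Put f_d(x) = x³ + bx² + cx + d with c = - b - 2 - N. Then
--   f_d(x) - f_e(y) = (y - x) k(x,y) + (d - e),
--   k(x,y) = N + 2 + b - b(x + y) - (x² + xy + y²),
-- so that ∣N - k∣ ≤ K = ∣b∣ + 2 on the unit square. If x is nearly a root of f_d with 1 ≤ d ≤ N,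
-- then k(x,·) ≥ ½ on [0,1], because k is concave in y, x k(x,0) ≈ d and (1 - x) k(x,1) ≈ N + 1 - d.
-- Hence points of [0,1] with small values of f_d are close to each other, which gives existence
-- of the root (as the limit of sign changes on finer and finer grids) and uniqueness. Consecutive
-- roots, at distance Δ, satisfy Δ k = 1, so N²Δ - N = (N - k)(1 + (N - k)Δ) is bounded by K(1 + K).
-- All estimates are made for rational approximations of the roots; their error accounts for the
-- final + 1 in the constant.
module Submission where

open import Data.Integer.Base using (ℤ; +_)

module Rationals where

  open import Data.Integer.Base as ℤ using (1ℤ)
  import Data.Integer.Properties as ℤ
  open import Data.Nat.Base as ℕ using (ℕ; zero; suc)
  import Data.Nat.Properties as ℕ
  open import Data.Product.Base using (∃-syntax; _×_; _,_)
  open import Data.Rational.Base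
  open import Data.Rational.Properties
  open import Data.Rational.Solver using (module +-*-Solver)
  import Data.Rational.Unnormalised.Base as ℚᵘ
  import Data.Rational.Unnormalised.Properties as ℚᵘ
  open import Data.Sum.Base using (inj₁; inj₂)
  open import Relation.Binary.PropositionalEquality
  open import Relation.Nullary.Negation using (contradiction)
  open +-*-Solver using (solve; con; _:=_; _:+_; _:*_; _:-_; :-_)

  -- Order and absolute value in the rationals.

  2ℚ ¼ : ℚ
  2ℚ = + 2 / 1
  ¼ = + 1 / 4

  0≤1 : 0ℚ ≤ 1ℚ
  0≤1 = nonNegative⁻¹ 1ℚ

  0≤p+q : ∀ {p q} → 0ℚ ≤ p → 0ℚ ≤ q → 0ℚ ≤ p + q
  0≤p+q = +-mono-≤ {0ℚ} {_} {0ℚ}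

  0≤p*q : ∀ {p q} → 0ℚ ≤ p → 0ℚ ≤ q → 0ℚ ≤ p * q
  0≤p*q {p} {q} 0≤p 0≤q =
    nonNegative⁻¹ (p * q) {{nonNeg*nonNeg⇒nonNeg p {{nonNegative 0≤p}} q {{nonNegative 0≤q}}}}

  p≤q⇒0≤q-p : ∀ {p q} → p ≤ q → 0ℚ ≤ q - p
  p≤q⇒0≤q-p {p} {q} p≤q = subst (_≤ q - p) (+-inverseʳ p) (+-monoˡ-≤ (- p) p≤q)

  0≤q-p⇒p≤q : ∀ {p q} → 0ℚ ≤ q - p → p ≤ q
  0≤q-p⇒p≤q {p} {q} 0≤q-p = subst₂ _≤_ (+-identityˡ p)
    (solve 2 (λ p q → q :- p :+ p := q) refl p q) (+-monoˡ-≤ p 0≤q-p)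

  -- The form in which the polynomial inequalities below are proved: a visibly nonnegative `r` is
  -- exhibited, and the ring solver identifies it with `q - p`.
  p≤q-by : ∀ {p q r} → 0ℚ ≤ r → r ≡ q - p → p ≤ q
  p≤q-by 0≤r eq = 0≤q-p⇒p≤q (subst (0ℚ ≤_) eq 0≤r)

  p≤∣p∣ : ∀ p → p ≤ ∣ p ∣
  p≤∣p∣ p with ∣p∣≡p∨∣p∣≡-p p
  ... | inj₁ e = ≤-reflexive (sym e)
  ... | inj₂ e with ≤-total 0ℚ p
  ...   | inj₁ 0≤p = ≤-reflexive (sym (0≤p⇒∣p∣≡p 0≤p))
  ...   | inj₂ p≤0 = ≤-trans p≤0 (0≤∣p∣ p)

  -p≤∣p∣ : ∀ p → - p ≤ ∣ p ∣
  -p≤∣p∣ p = subst (- p ≤_) (∣-p∣≡∣p∣ p) (p≤∣p∣ (- p))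

  ∣p∣≤q : ∀ {p q} → p ≤ q → - p ≤ q → ∣ p ∣ ≤ q
  ∣p∣≤q {p} {q} p≤q -p≤q with ∣p∣≡p∨∣p∣≡-p p
  ... | inj₁ e = subst (_≤ q) (sym e) p≤q
  ... | inj₂ e = subst (_≤ q) (sym e) -p≤q

  ∣p+q∣≤ : ∀ {p q r s} → ∣ p ∣ ≤ r → ∣ q ∣ ≤ s → ∣ p + q ∣ ≤ r + s
  ∣p+q∣≤ {p} {q} p≤r q≤s = ≤-trans (∣p+q∣≤∣p∣+∣q∣ p q) (+-mono-≤ p≤r q≤s)

  ∣p*q∣≤ : ∀ {p q r s} → ∣ p ∣ ≤ r → ∣ q ∣ ≤ s → ∣ p * q ∣ ≤ r * s
  ∣p*q∣≤ {p} {q} {r} {s} p≤r q≤s = begin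
    ∣ p * q ∣      ≡⟨ ∣p*q∣≡∣p∣*∣q∣ p q ⟩
    ∣ p ∣ * ∣ q ∣  ≤⟨ *-monoʳ-≤-nonNeg ∣ q ∣ {{∣-∣-nonNeg q}} p≤r ⟩
    r * ∣ q ∣      ≤⟨ *-monoˡ-≤-nonNeg r {{nonNegative (≤-trans (0≤∣p∣ p) p≤r)}} q≤s ⟩
    r * s          ∎
    where open ≤-Reasoning

  -- Integers and unit fractions inside the rationals.

  /1-homo-+ : ∀ i j → (i ℤ.+ j) / 1 ≡ i / 1 + j / 1
  -- The computation takes place among unnormalised fractions, where no common factors are
  -- cancelled.
  /1-homo-+ i j = toℚᵘ-injective (begin
    toℚᵘ ((i ℤ.+ j) / 1)          ≈⟨ toℚᵘ-fromℚᵘ (ℚᵘ.mkℚᵘ (i ℤ.+ j) 0) ⟩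
    ℚᵘ.mkℚᵘ (i ℤ.+ j) 0           ≈⟨ ℚᵘ.*≡* (cong (ℤ._* 1ℤ)
                                       (sym (cong₂ ℤ._+_ (ℤ.*-identityʳ i) (ℤ.*-identityʳ j)))) ⟩
    ℚᵘ.mkℚᵘ i 0 ℚᵘ.+ ℚᵘ.mkℚᵘ j 0  ≈⟨ ℚᵘ.+-cong (toℚᵘ-fromℚᵘ (ℚᵘ.mkℚᵘ i 0)) (toℚᵘ-fromℚᵘ (ℚᵘ.mkℚᵘ j 0)) ⟨
    toℚᵘ (i / 1) ℚᵘ.+ toℚᵘ (j / 1) ≈⟨ toℚᵘ-homo-+ (i / 1) (j / 1) ⟨
    toℚᵘ (i / 1 + j / 1)          ∎)
    where open import Relation.Binary.Reasoning.Setoid ℚᵘ.≃-setoid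

  /1-homo-neg : ∀ i → (ℤ.- i) / 1 ≡ - (i / 1)
  /1-homo-neg i = begin
    (ℤ.- i) / 1                         ≡⟨ solve 2 (λ p q → q := p :+ q :- p) refl (i / 1) _ ⟩
    i / 1 + (ℤ.- i) / 1 - i / 1         ≡⟨ cong (_- (i / 1)) (/1-homo-+ i (ℤ.- i)) ⟨
    (i ℤ.+ ℤ.- i) / 1 - i / 1           ≡⟨ cong (λ j → j / 1 - i / 1) (ℤ.+-inverseʳ i) ⟩
    0ℚ - i / 1                          ≡⟨ +-identityˡ _ ⟩
    - (i / 1)                           ∎
    where open ≡-Reasoning

  /1-homo-- : ∀ i j → (i ℤ.- j) / 1 ≡ i / 1 - j / 1
  /1-homo-- i j = trans (/1-homo-+ i (ℤ.- j)) (cong (λ q → i / 1 + q) (/1-homo-neg j))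

  /1-mono-≤ : ∀ {i j} → i ℤ.≤ j → i / 1 ≤ j / 1
  /1-mono-≤ {i} {j} i≤j = toℚᵘ-cancel-≤
    (ℚᵘ.≤-respˡ-≃ (ℚᵘ.≃-sym (toℚᵘ-fromℚᵘ (ℚᵘ.mkℚᵘ i 0)))
    (ℚᵘ.≤-respʳ-≃ (ℚᵘ.≃-sym (toℚᵘ-fromℚᵘ (ℚᵘ.mkℚᵘ j 0)))
      (ℚᵘ.*≤* (ℤ.*-monoʳ-≤-nonNeg 1ℤ i≤j))))

  n/1*1/n : ∀ n .{{_ : ℕ.NonZero n}} → (+ n / 1) * (1ℤ / n) ≡ 1ℚ
  n/1*1/n n@(suc m) = toℚᵘ-injective (begin
    toℚᵘ ((+ n / 1) * (1ℤ / n))             ≈⟨ toℚᵘ-homo-* (+ n / 1) (1ℤ / n) ⟩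
    toℚᵘ (+ n / 1) ℚᵘ.* toℚᵘ (1ℤ / n)       ≈⟨ ℚᵘ.*-cong (toℚᵘ-fromℚᵘ (ℚᵘ.mkℚᵘ (+ n) 0)) (toℚᵘ-fromℚᵘ (ℚᵘ.mkℚᵘ 1ℤ m)) ⟩
    ℚᵘ.mkℚᵘ (+ n) 0 ℚᵘ.* ℚᵘ.mkℚᵘ 1ℤ m       ≈⟨ ℚᵘ.*≡* (trans (ℤ.*-identityʳ (+ n ℤ.* 1ℤ)) (trans (ℤ.*-identityʳ (+ n))
                                                 (sym (trans (ℤ.*-identityˡ (+ (1 ℕ.* n))) (cong +_ (ℕ.*-identityˡ n)))))) ⟩
    toℚᵘ 1ℚ                                 ∎)
    where open import Relation.Binary.Reasoning.Setoid ℚᵘ.≃-setoid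

  0≤1/n : ∀ n .{{_ : ℕ.NonZero n}} → 0ℚ ≤ 1ℤ / n
  0≤1/n n = nonNegative⁻¹ (1ℤ / n) {{normalize-nonNeg 1 n}}

  -- Arbitrarily fine meshes and sign changes.

  archimedean : ∀ p → ∃[ n ] p ≤ + n / 1
  archimedean p@(mkℚ i d _) = ℤ.∣ i ∣ , toℚᵘ-cancel-≤
    (ℚᵘ.≤-respʳ-≃ (ℚᵘ.≃-sym (toℚᵘ-fromℚᵘ (ℚᵘ.mkℚᵘ (+ ℤ.∣ i ∣) 0))) (ℚᵘ.*≤* (begin
      i ℤ.* 1ℤ               ≡⟨ ℤ.*-identityʳ i ⟩
      i                      ≤⟨ i≤∣i∣ i ⟩
      + ℤ.∣ i ∣              ≡⟨ ℤ.*-identityʳ _ ⟨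
      + ℤ.∣ i ∣ ℤ.* 1ℤ       ≤⟨ ℤ.*-monoˡ-≤-nonNeg (+ ℤ.∣ i ∣) (ℤ.+≤+ (ℕ.s≤s ℕ.z≤n)) ⟩
      + ℤ.∣ i ∣ ℤ.* + suc d  ∎)))
    where
    open ℤ.≤-Reasoning
    i≤∣i∣ : ∀ i → i ℤ.≤ + ℤ.∣ i ∣
    i≤∣i∣ (+ n) = ℤ.≤-refl
    i≤∣i∣ ℤ.-[1+ n ] = ℤ.-≤+

  abstract

    mesh : ℕ → ℚ
    mesh m = 1ℤ / suc m

    1+m*mesh : ∀ m → (+ suc m / 1) * mesh m ≡ 1ℚ
    1+m*mesh m = n/1*1/n (suc m)

    0<mesh : ∀ m → 0ℚ < mesh m
    0<mesh m = positive⁻¹ (mesh m) {{normalize-pos 1 (suc m)}}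

  0≤mesh : ∀ m → 0ℚ ≤ mesh m
  0≤mesh m = <⇒≤ (0<mesh m)

  mesh-vanishes : ∀ p ε → 0ℚ < ε → ∃[ M ] ∀ m → M ℕ.≤ m → p * mesh m < ε
  mesh-vanishes p ε 0<ε with archimedean (p * (1/ ε) {{pos⇒nonZero ε {{positive 0<ε}}}})
  -- The threshold is a natural number above `p / ε`; the inequality is checked after multiplication
  -- by `1 + m`.
  ... | M , bound = M , λ m M≤m → *-cancelʳ-<-nonNeg (+ suc m / 1) {{normalize-nonNeg (suc m) 1}} (begin-strict
    p * mesh m * (+ suc m / 1)        ≡⟨ solve 3 (λ p q r → p :* q :* r := p :* (r :* q)) refl p (mesh m) (+ suc m / 1) ⟩
    p * ((+ suc m / 1) * mesh m)        ≡⟨ cong (p *_) (1+m*mesh m) ⟩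
    p * 1ℚ                              ≡⟨ cong (p *_) (*-inverseˡ ε) ⟨
    p * (1/ ε * ε)                      ≡⟨ *-assoc p (1/ ε) ε ⟨
    p * 1/ ε * ε                        ≤⟨ *-monoʳ-≤-nonNeg ε {{pos⇒nonNeg ε}} bound ⟩
    (+ M / 1) * ε                       <⟨ *-monoˡ-<-pos ε (M<1+m M≤m) ⟩
    (+ suc m / 1) * ε                   ≡⟨ *-comm _ ε ⟩
    ε * (+ suc m / 1)                   ∎)
    where
    open ≤-Reasoning
    instance
      ε-pos : Positive ε
      ε-pos = positive 0<ε
      ε-nz : NonZero ε
      ε-nz = pos⇒nonZero ε
    M<1+m : ∀ {m} → M ℕ.≤ m → + M / 1 < + suc m / 1
    M<1+m {m} M≤m = ≤-<-trans (/1-mono-≤ (ℤ.+≤+ M≤m))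
      (subst₂ _<_ (+-identityˡ _) (sym (/1-homo-+ 1ℤ (+ m))) (+-monoˡ-< (+ m / 1) (positive⁻¹ 1ℚ)))

  -- Search from the right end: either the last interval is a sign change, or its left end takes
  -- over as the new right end.
  discreteIVT : ∀ (f : ℕ → ℚ) m → 0ℚ ≤ f 0 → f (suc m) ≤ 0ℚ →
    ∃[ i ] i ℕ.≤ m × 0ℚ ≤ f i × f (suc i) ≤ 0ℚ
  discreteIVT f zero 0≤f0 f1≤0 = 0 , ℕ.z≤n , 0≤f0 , f1≤0
  discreteIVT f (suc m) 0≤f0 f[2+m]≤0 with ≤-total 0ℚ (f (suc m))
  ... | inj₁ 0≤f[1+m] = suc m , ℕ.≤-refl , 0≤f[1+m] , f[2+m]≤0
  ... | inj₂ f[1+m]≤0 with discreteIVT f m 0≤f0 f[1+m]≤0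
  ...   | i , i≤m , 0≤fi , f[1+i]≤0 = i , ℕ.m≤n⇒m≤1+n i≤m , 0≤fi , f[1+i]≤0

  -- The cubic and its secant slopes.

  cubic : ℚ → ℚ → ℚ → ℚ → ℚ
  cubic b c d x = x * (x * (x * 1ℚ)) + b * (x * (x * 1ℚ)) + c * x + d

  -- The negated divided difference of `cubic` for c = - b - 2 - n, with the division carried out,
  -- so that it also makes sense at x = y.
  slope : ℚ → ℚ → ℚ → ℚ → ℚ
  slope b n x y = n + 2ℚ + b - b * (x + y) - (x * x + x * y + y * y)

  slope-comm : ∀ b n x y → slope b n x y ≡ slope b n y x
  slope-comm = solve 4 (λ b n x y →
    n :+ con 2ℚ :+ b :- b :* (x :+ y) :- (x :* x :+ x :* y :+ y :* y) :=
    n :+ con 2ℚ :+ b :- b :* (y :+ x) :- (y :* y :+ y :* x :+ x :* x)) refl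

  cubic-secant : ∀ b n d e x y →
    cubic b (- b - 2ℚ - n) d x - cubic b (- b - 2ℚ - n) e y ≡ (y - x) * slope b n x y + (d - e)
  cubic-secant = solve 6 (λ b n d e x y →
    (x :* (x :* (x :* con 1ℚ)) :+ b :* (x :* (x :* con 1ℚ)) :+ (:- b :- con 2ℚ :- n) :* x :+ d)
      :- (y :* (y :* (y :* con 1ℚ)) :+ b :* (y :* (y :* con 1ℚ)) :+ (:- b :- con 2ℚ :- n) :* y :+ e)
    := (y :- x) :* (n :+ con 2ℚ :+ b :- b :* (x :+ y) :- (x :* x :+ x :* y :+ y :* y)) :+ (d :- e)) refl

  -- In `y` the slope is quadratic with leading coefficient - 1, so it lies above its chord over
  -- [0,1] by exactly y (1 - y).
  slope-concave : ∀ b n x y →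
    (1ℚ - y) * (slope b n x 0ℚ - ½) + y * (slope b n x 1ℚ - ½) + y * (1ℚ - y) ≡ slope b n x y - ½
  slope-concave = solve 4 (λ b n x y →
    (con 1ℚ :- y) :* (n :+ con 2ℚ :+ b :- b :* (x :+ con 0ℚ) :- (x :* x :+ x :* con 0ℚ :+ con 0ℚ :* con 0ℚ) :- con ½)
    :+ y :* (n :+ con 2ℚ :+ b :- b :* (x :+ con 1ℚ) :- (x :* x :+ x :* con 1ℚ :+ con 1ℚ :* con 1ℚ) :- con ½)
    :+ y :* (con 1ℚ :- y)
    := n :+ con 2ℚ :+ b :- b :* (x :+ y) :- (x :* x :+ x :* y :+ y :* y) :- con ½) refl

  -- The unit interval and its grids.

  InUnit : ℚ → Set
  InUnit x = 0ℚ ≤ x × x ≤ 1ℚ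

  0∈I : InUnit 0ℚ
  0∈I = ≤-refl , 0≤1

  1∈I : InUnit 1ℚ
  1∈I = 0≤1 , ≤-refl

  ∣y-x∣≤1 : ∀ {x y} → InUnit x → InUnit y → ∣ y - x ∣ ≤ 1ℚ
  ∣y-x∣≤1 {x} {y} (0≤x , x≤1) (0≤y , y≤1) = ∣p∣≤q
    (p≤q-by (0≤p+q (p≤q⇒0≤q-p y≤1) 0≤x)
      (solve 2 (λ x y → con 1ℚ :- y :+ x := con 1ℚ :- (y :- x)) refl x y))
    (p≤q-by (0≤p+q (p≤q⇒0≤q-p x≤1) 0≤y)
      (solve 2 (λ x y → con 1ℚ :- x :+ y := con 1ℚ :- (:- (y :- x))) refl x y))

  ½≤cofactor : ∀ {x k} → InUnit x → ½ ≤ x * k → ½ ≤ k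
  ½≤cofactor {x} {k} (0≤x , x≤1) ½≤xk with ≤-total 0ℚ k
  ... | inj₁ 0≤k = ≤-trans ½≤xk
    (subst (x * k ≤_) (*-identityˡ k) (*-monoʳ-≤-nonNeg k {{nonNegative 0≤k}} x≤1))
  ... | inj₂ k≤0 = contradiction refl (<⇒≢ (<-≤-trans (positive⁻¹ ½) (≤-trans ½≤xk
    (subst (x * k ≤_) (*-zeroʳ x) (*-monoˡ-≤-nonNeg x {{nonNegative 0≤x}} k≤0)))))

  0<p*q⇒0<p : ∀ {p q} → 0ℚ ≤ q → 0ℚ < p * q → 0ℚ < p
  0<p*q⇒0<p {p} {q} 0≤q 0<pq = *-cancelʳ-<-nonNeg q {{nonNegative 0≤q}}
    (subst (_< p * q) (sym (*-zeroˡ q)) 0<pq)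

  abstract

    grid : ℕ → ℕ → ℚ
    grid m i = (+ i / 1) * mesh m

    grid-start : ∀ m → grid m 0 ≡ 0ℚ
    grid-start m = *-zeroˡ (mesh m)

    grid-end : ∀ m → grid m (suc m) ≡ 1ℚ
    grid-end m = 1+m*mesh m

    grid-step : ∀ m i → grid m (suc i) ≡ mesh m + grid m i
    grid-step m i = begin
      (+ suc i / 1) * mesh m     ≡⟨ cong (_* mesh m) (/1-homo-+ 1ℤ (+ i)) ⟩
      (1ℚ + + i / 1) * mesh m    ≡⟨ *-distribʳ-+ (mesh m) 1ℚ (+ i / 1) ⟩
      1ℚ * mesh m + grid m i     ≡⟨ cong (_+ grid m i) (*-identityˡ (mesh m)) ⟩
      mesh m + grid m i          ∎
      where open ≡-Reasoning

    grid∈I : ∀ m {i} → i ℕ.≤ suc m → InUnit (grid m i)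
    grid∈I m {i} i≤1+m =
      0≤p*q (nonNegative⁻¹ (+ i / 1) {{normalize-nonNeg i 1}}) (0≤mesh m) ,
      subst (grid m i ≤_) (grid-end m)
        (*-monoʳ-≤-nonNeg (mesh m) {{nonNegative (0≤mesh m)}} (/1-mono-≤ (ℤ.+≤+ i≤1+m)))

  -- Both depend on `b` alone, which makes the final constant independent of N. The factors `1ℚ`
  -- record the bounds for x + y - 1 and for the gap y - x, in the shape produced by `∣p*q∣≤`.
  slopeDeviation gapConstant : ℚ → ℚ
  slopeDeviation b = ∣ b ∣ * 1ℚ + 2ℚ
  gapConstant b = slopeDeviation b * (1ℚ + slopeDeviation b * 1ℚ) + 1ℚ

  -- Estimates for the cubics with fixed `b` and `n`.

  module Cubic (b c n : ℚ) (c-eq : c ≡ - b - 2ℚ - n) (1≤n : 1ℚ ≤ n) where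

    f : ℚ → ℚ → ℚ
    f = cubic b c

    k : ℚ → ℚ → ℚ
    k = slope b n

    K L C : ℚ
    K = slopeDeviation b
    L = K + n
    C = gapConstant b

    0≤n : 0ℚ ≤ n
    0≤n = ≤-trans 0≤1 1≤n

    0≤K : 0ℚ ≤ K
    0≤K = 0≤p+q (0≤p*q (0≤∣p∣ b) 0≤1) (nonNegative⁻¹ 2ℚ)

    0≤L : 0ℚ ≤ L
    0≤L = 0≤p+q 0≤K 0≤n

    f-secant : ∀ d e x y → f d x - f e y ≡ (y - x) * k x y + (d - e)
    f-secant d e x y = subst
      (λ c → cubic b c d x - cubic b c e y ≡ (y - x) * k x y + (d - e)) (sym c-eq)
      (cubic-secant b n d e x y)

    f-at-0 : ∀ d → f d 0ℚ ≡ d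
    f-at-0 = solve 3 (λ b c d →
      con 0ℚ :* (con 0ℚ :* (con 0ℚ :* con 1ℚ)) :+ b :* (con 0ℚ :* (con 0ℚ :* con 1ℚ))
        :+ c :* con 0ℚ :+ d := d) refl b c

    f-at-1 : ∀ d → f d 1ℚ ≡ d - (n + 1ℚ)
    f-at-1 d = subst (λ c → cubic b c d 1ℚ ≡ d - (n + 1ℚ)) (sym c-eq)
      (solve 3 (λ b n d →
        con 1ℚ :* (con 1ℚ :* (con 1ℚ :* con 1ℚ)) :+ b :* (con 1ℚ :* (con 1ℚ :* con 1ℚ))
          :+ (:- b :- con 2ℚ :- n) :* con 1ℚ :+ d := d :- (n :+ con 1ℚ)) refl b n d)

    -- The difference equals b (x + y - 1) + (s - 2) with s = x² + xy + y². On the unit square x + y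
    -- - 1 lies in [-1,1], and s lies in [0,3].
    ∣n-k∣≤K : ∀ {x y} → InUnit x → InUnit y → ∣ n - k x y ∣ ≤ K
    ∣n-k∣≤K {x} {y} (0≤x , x≤1) (0≤y , y≤1) = subst (λ p → ∣ p ∣ ≤ K)
      (solve 4 (λ b n x y → b :* (x :+ y :- con 1ℚ) :+ (x :* x :+ x :* y :+ y :* y :- con 2ℚ)
        := n :- (n :+ con 2ℚ :+ b :- b :* (x :+ y) :- (x :* x :+ x :* y :+ y :* y))) refl b n x y)
      (∣p+q∣≤ (∣p*q∣≤ (≤-refl {∣ b ∣}) ∣x+y-1∣≤1) ∣s-2∣≤2)
      where
      0≤1-x : 0ℚ ≤ 1ℚ - x
      0≤1-x = p≤q⇒0≤q-p x≤1
      0≤1-y : 0ℚ ≤ 1ℚ - y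
      0≤1-y = p≤q⇒0≤q-p y≤1
      s : ℚ
      s = x * x + x * y + y * y
      ∣x+y-1∣≤1 : ∣ x + y - 1ℚ ∣ ≤ 1ℚ
      ∣x+y-1∣≤1 = ∣p∣≤q
        (p≤q-by (0≤p+q 0≤1-x 0≤1-y)
          (solve 2 (λ x y → (con 1ℚ :- x) :+ (con 1ℚ :- y) := con 1ℚ :- (x :+ y :- con 1ℚ)) refl x y))
        (p≤q-by (0≤p+q 0≤x 0≤y)
          (solve 2 (λ x y → x :+ y := con 1ℚ :- (:- (x :+ y :- con 1ℚ))) refl x y))
      ∣s-2∣≤2 : ∣ s - 2ℚ ∣ ≤ 2ℚ
      ∣s-2∣≤2 = ∣p∣≤q
        (p≤q-by
          -- Here 4 - s is written as (1 - x²) + (1 - y²) + (1 - xy) + 1, the first two terms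
          -- factored and the third split as (1 - x) + x (1 - y).
          (0≤p+q (0≤p+q (0≤p+q (0≤p*q 0≤1-x (0≤p+q 0≤1 0≤x)) (0≤p*q 0≤1-y (0≤p+q 0≤1 0≤y)))
                        (0≤p+q 0≤1-x (0≤p*q 0≤x 0≤1-y))) 0≤1)
          (solve 2 (λ x y → (con 1ℚ :- x) :* (con 1ℚ :+ x) :+ (con 1ℚ :- y) :* (con 1ℚ :+ y)
              :+ ((con 1ℚ :- x) :+ x :* (con 1ℚ :- y)) :+ con 1ℚ
            := con 2ℚ :- (x :* x :+ x :* y :+ y :* y :- con 2ℚ)) refl x y))
        (p≤q-by (0≤p+q (0≤p+q (0≤p*q 0≤x 0≤x) (0≤p*q 0≤x 0≤y)) (0≤p*q 0≤y 0≤y))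
          (solve 2 (λ x y → x :* x :+ x :* y :+ y :* y
            := con 2ℚ :- (:- (x :* x :+ x :* y :+ y :* y :- con 2ℚ))) refl x y))

    k≤L : ∀ {x y} → InUnit x → InUnit y → k x y ≤ L
    k≤L {x} {y} x∈I y∈I = p≤q-by
      (p≤q⇒0≤q-p (≤-trans (-p≤∣p∣ (n - k x y)) (∣n-k∣≤K x∈I y∈I)))
      (solve 3 (λ K k n → K :- (:- (n :- k)) := K :+ n :- k) refl K (k x y) n)

    secant-root : ∀ d x e y → f e y ≡ 0ℚ → f d x ≡ (y - x) * k x y + (d - e)
    secant-root d x e y fey≡0 = begin
      f d x                        ≡⟨ +-identityʳ (f d x) ⟨
      f d x - 0ℚ                   ≡⟨ cong (λ p → f d x - p) fey≡0 ⟨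
      f d x - f e y                ≡⟨ f-secant d e x y ⟩
      (y - x) * k x y + (d - e)    ∎
      where open ≡-Reasoning

    -- The constant terms 0 and n + 1, just outside the admissible range, have the exact roots 0 and
    -- 1. These serve to bound the slope from below and to keep the other roots away from the ends
    -- of the interval.
    f-0-0 : f 0ℚ 0ℚ ≡ 0ℚ
    f-0-0 = f-at-0 0ℚ

    f-n+1-1 : f (n + 1ℚ) 1ℚ ≡ 0ℚ
    f-n+1-1 = trans (f-at-1 (n + 1ℚ)) (+-inverseʳ (n + 1ℚ))

    -- k x is concave, so it suffices to bound it at 0 and at 1, where it is a secant slope
    -- towards an exact root of the cubic for d = 0 and for d = n + 1, respectively.
    ½≤k : ∀ {d x y} → 1ℚ ≤ d → d ≤ n → InUnit x → ∣ f d x ∣ ≤ ½ → InUnit y → ½ ≤ k x y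
    ½≤k {d} {x} {y} 1≤d d≤n x∈I@(0≤x , x≤1) small (0≤y , y≤1) = p≤q-by
      (0≤p+q (0≤p+q (0≤p*q 0≤1-y (p≤q⇒0≤q-p ½≤k[x,0])) (0≤p*q 0≤y (p≤q⇒0≤q-p ½≤k[x,1])))
             (0≤p*q 0≤y 0≤1-y))
      (slope-concave b n x y)
      where
      0≤1-y : 0ℚ ≤ 1ℚ - y
      0≤1-y = p≤q⇒0≤q-p y≤1
      ½≤k[x,0] : ½ ≤ k x 0ℚ
      ½≤k[x,0] = ½≤cofactor x∈I (p≤q-by
        (0≤p+q (p≤q⇒0≤q-p 1≤d) (p≤q⇒0≤q-p (≤-trans (p≤∣p∣ (f d x)) small)))
        (trans (cong (λ p → d - 1ℚ + (½ - p)) (secant-root d x 0ℚ 0ℚ f-0-0))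
          (solve 3 (λ x k d → d :- con 1ℚ :+ (con ½ :- ((con 0ℚ :- x) :* k :+ (d :- con 0ℚ)))
            := x :* k :- con ½) refl x (k x 0ℚ) d)))
      ½≤k[x,1] : ½ ≤ k x 1ℚ
      ½≤k[x,1] = ½≤cofactor
        ( p≤q⇒0≤q-p x≤1
        , p≤q-by 0≤x (solve 1 (λ x → x := con 1ℚ :- (con 1ℚ :- x)) refl x))
        (p≤q-by
          (0≤p+q (p≤q⇒0≤q-p d≤n) (p≤q⇒0≤q-p (≤-trans (-p≤∣p∣ (f d x)) small)))
          (trans (cong (λ p → n - d + (½ - (- p))) (secant-root d x (n + 1ℚ) 1ℚ f-n+1-1))
            (solve 4 (λ x k d n →
              n :- d :+ (con ½ :- (:- ((con 1ℚ :- x) :* k :+ (d :- (n :+ con 1ℚ)))))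
              := (con 1ℚ :- x) :* k :- con ½) refl x (k x 1ℚ) d n)))

    -- The value at the left end is at most the drop across the step, and this drop is `h` times a
    -- slope bounded by `L`.
    ∣f∣-at-signChange : ∀ {d x h} → InUnit x → InUnit (h + x) → 0ℚ ≤ h →
      0ℚ ≤ f d x → f d (h + x) ≤ 0ℚ → ∣ f d x ∣ ≤ L * h
    ∣f∣-at-signChange {d} {x} {h} x∈I h+x∈I 0≤h 0≤fx f[h+x]≤0 = begin
      ∣ f d x ∣                            ≡⟨ 0≤p⇒∣p∣≡p 0≤fx ⟩
      f d x                                ≡⟨ +-identityʳ (f d x) ⟨
      f d x - 0ℚ                           ≤⟨ +-monoʳ-≤ (f d x) (neg-antimono-≤ f[h+x]≤0) ⟩
      f d x - f d (h + x)                  ≡⟨ f-secant d d x (h + x) ⟩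
      (h + x - x) * k x (h + x) + (d - d)  ≡⟨ solve 4 (λ h x κ d → (h :+ x :- x) :* κ :+ (d :- d) := κ :* h)
                                                refl h x (k x (h + x)) d ⟩
      k x (h + x) * h                      ≤⟨ *-monoʳ-≤-nonNeg h {{nonNegative 0≤h}} (k≤L x∈I h+x∈I) ⟩
      L * h                                ∎
      where open ≤-Reasoning

    0≤f-at-0 : ∀ {d} → 0ℚ ≤ d → 0ℚ ≤ f d 0ℚ
    0≤f-at-0 {d} = subst (0ℚ ≤_) (sym (f-at-0 d))

    f-at-1≤0 : ∀ {d} → d ≤ n → f d 1ℚ ≤ 0ℚ
    f-at-1≤0 {d} d≤n = subst (_≤ 0ℚ) (sym (f-at-1 d)) (p≤q-by (0≤p+q (p≤q⇒0≤q-p d≤n) 0≤1)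
      (solve 2 (λ d n → n :- d :+ con 1ℚ := con 0ℚ :- (d :- (n :+ con 1ℚ))) refl d n))

    signChange : ∀ {d} → 0ℚ ≤ d → d ≤ n → ∀ m →
      ∃[ i ] i ℕ.≤ m × 0ℚ ≤ f d (grid m i) × f d (grid m (suc i)) ≤ 0ℚ
    signChange {d} 0≤d d≤n m = discreteIVT (λ i → f d (grid m i)) m
      (subst (λ x → 0ℚ ≤ f d x) (sym (grid-start m)) (0≤f-at-0 0≤d))
      (subst (λ x → f d x ≤ 0ℚ) (sym (grid-end m)) (f-at-1≤0 d≤n))

    approximateRoot : ∀ {d} → 0ℚ ≤ d → d ≤ n → ∀ m →
      ∃[ x ] InUnit x × ∣ f d x ∣ ≤ L * mesh m
    approximateRoot {d} 0≤d d≤n m = atSignChange (signChange 0≤d d≤n m)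
      where
      atSignChange : (∃[ i ] i ℕ.≤ m × 0ℚ ≤ f d (grid m i) × f d (grid m (suc i)) ≤ 0ℚ) →
        ∃[ x ] InUnit x × ∣ f d x ∣ ≤ L * mesh m
      atSignChange (i , i≤m , 0≤f[i] , f[1+i]≤0) = grid m i , i∈I ,
        ∣f∣-at-signChange {d} {grid m i} {mesh m} i∈I i+1∈I (0≤mesh m) 0≤f[i] f[i+1]≤0
        where
        i∈I : InUnit (grid m i)
        i∈I = grid∈I m {i} (ℕ.m≤n⇒m≤1+n i≤m)
        i+1∈I : InUnit (mesh m + grid m i)
        i+1∈I = subst InUnit (grid-step m i) (grid∈I m {suc i} (ℕ.s≤s i≤m))
        f[i+1]≤0 : f d (mesh m + grid m i) ≤ 0ℚ
        f[i+1]≤0 = subst (λ x → f d x ≤ 0ℚ) (grid-step m i) f[1+i]≤0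

    -- For equal constant terms the secant identity reads f x - f y = (y - x) k, and k is at least
    -- ½.
    ∣y-x∣≤2∣fx-fy∣ : ∀ {d x y} → ½ ≤ k x y → ∣ y - x ∣ ≤ 2ℚ * ∣ f d x - f d y ∣
    ∣y-x∣≤2∣fx-fy∣ {d} {x} {y} ½≤k = begin
      ∣ y - x ∣                  ≡⟨ solve 1 (λ p → p := con 2ℚ :* (p :* con ½)) refl ∣ y - x ∣ ⟩
      2ℚ * (∣ y - x ∣ * ½)       ≤⟨ *-monoˡ-≤-nonNeg 2ℚ (*-monoˡ-≤-nonNeg ∣ y - x ∣ {{∣-∣-nonNeg (y - x)}}
                                     (≤-trans ½≤k (p≤∣p∣ (k x y)))) ⟩
      2ℚ * (∣ y - x ∣ * ∣ k x y ∣)  ≡⟨ cong (2ℚ *_) (∣p*q∣≡∣p∣*∣q∣ (y - x) (k x y)) ⟨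
      2ℚ * ∣ (y - x) * k x y ∣   ≡⟨ cong (λ p → 2ℚ * ∣ p ∣) (solve 2 (λ p d → p := p :+ (d :- d)) refl ((y - x) * k x y) d) ⟩
      2ℚ * ∣ (y - x) * k x y + (d - d) ∣ ≡⟨ cong (λ p → 2ℚ * ∣ p ∣) (f-secant d d x y) ⟨
      2ℚ * ∣ f d x - f d y ∣     ∎
      where open ≤-Reasoning

    -- Quantitative uniqueness of the root. It makes the approximations a Cauchy sequence, and it
    -- identifies any given root with their limit.
    rootDistance : ∀ {d x y} → 1ℚ ≤ d → d ≤ n → InUnit x → InUnit y → ∣ f d x ∣ ≤ ½ → ∀ {ε} →
      ∣ f d x ∣ < ¼ * ε → ∣ f d y ∣ < ¼ * ε → ∣ x - y ∣ < ε
    rootDistance {d} {x} {y} 1≤d d≤n x∈I y∈I small {ε} fx fy = begin-strict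
      ∣ x - y ∣                        ≡⟨ ∣-p∣≡∣p∣ (x - y) ⟨
      ∣ - (x - y) ∣                    ≡⟨ cong ∣_∣ (solve 2 (λ x y → :- (x :- y) := y :- x) refl x y) ⟩
      ∣ y - x ∣                        ≤⟨ ∣y-x∣≤2∣fx-fy∣ {d} {x} {y} (½≤k {d} {x} {y} 1≤d d≤n x∈I small y∈I) ⟩
      2ℚ * ∣ f d x - f d y ∣           ≤⟨ *-monoˡ-≤-nonNeg 2ℚ (∣p-q∣≤∣p∣+∣q∣ (f d x) (f d y)) ⟩
      2ℚ * (∣ f d x ∣ + ∣ f d y ∣)     <⟨ *-monoʳ-<-pos 2ℚ (+-mono-< fx fy) ⟩
      2ℚ * (¼ * ε + ¼ * ε)             ≡⟨ solve 1 (λ ε → con 2ℚ :* (con ¼ :* ε :+ con ¼ :* ε) := ε) refl ε ⟩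
      ε                                ∎
      where open ≤-Reasoning

    -- By the secant identity (y - x) k = (e - d) + f d x - f e y, which is at least 1 - ¼ - ¼ = ½
    -- and so exceeds L η. Since k is at most L, it follows that y - x exceeds η.
    separation : ∀ {d e x y η} → d + 1ℚ ≤ e → InUnit x → InUnit y →
      ∣ f d x ∣ ≤ ¼ → ∣ f e y ∣ ≤ ¼ → ½ ≤ k x y → L * η < ½ → x + η < y
    separation {d} {e} {x} {y} {η} d+1≤e x∈I y∈I fx fy ½≤k Lη<½ = subst₂ _<_ (+-comm η x)
      (solve 2 (λ x y → y :- x :+ x := y) refl x y)
      (+-monoˡ-< x {η} {y - x} (*-cancelʳ-<-nonNeg L {{nonNegative 0≤L}} (begin-strict
        η * L                         ≡⟨ *-comm η L ⟩
        L * η                         <⟨ Lη<½ ⟩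
        ½                             ≤⟨ ½≤[y-x]k ⟩
        (y - x) * k x y               ≤⟨ *-monoˡ-≤-nonNeg (y - x) {{nonNegative 0≤y-x}} (k≤L {x} {y} x∈I y∈I) ⟩
        (y - x) * L                   ∎)))
      where
      open ≤-Reasoning
      ½≤[y-x]k : ½ ≤ (y - x) * k x y
      ½≤[y-x]k = p≤q-by
        (0≤p+q (p≤q⇒0≤q-p d+1≤e)
          (0≤p+q (p≤q⇒0≤q-p (≤-trans (-p≤∣p∣ (f d x)) fx)) (p≤q⇒0≤q-p (≤-trans (p≤∣p∣ (f e y)) fy))))
        (trans (solve 4 (λ d e p q → e :- (d :+ con 1ℚ) :+ ((con ¼ :- :- p) :+ (con ¼ :- q))
                 := p :- q :- (d :- e) :- con ½) refl d e (f d x) (f e y))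
        (trans (cong (λ p → p - (d - e) - ½) (f-secant d e x y))
          (solve 3 (λ p d e → p :+ (d :- e) :- (d :- e) :- con ½ := p :- con ½) refl ((y - x) * k x y) d e)))
      -- The sign of y - x is settled first, from k > 0; only then may k be replaced by the larger
      -- L.
      0≤y-x : 0ℚ ≤ y - x
      0≤y-x = <⇒≤ (0<p*q⇒0<p (≤-trans (<⇒≤ (positive⁻¹ ½)) ½≤k) (<-≤-trans (positive⁻¹ ½) ½≤[y-x]k))

    -- With u = n - k and Δ k = 1 + ε, where ε is the error from inexact roots, n²Δ - n = u (1 + uΔ)
    -- + (u + n) ε. The hypothesis on the values of `f` bounds the last term by 1; multiplication by
    -- w² = 1/n² gives the claim.
    gap : ∀ {d e x y w} → e ≡ d + 1ℚ → InUnit x → InUnit y → 0ℚ ≤ w → n * w ≡ 1ℚ →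
      L * (∣ f d x ∣ + ∣ f e y ∣) ≤ 1ℚ → ∣ y - x - w ∣ ≤ C * (w * (w * 1ℚ))
    gap {d} {e} {x} {y} {w} e≡d+1 x∈I y∈I 0≤w nw≡1 small = begin
      ∣ Δ - w ∣                                       ≡⟨ cong ∣_∣ Δ-w ⟩
      ∣ (u * (1ℚ + u * Δ) + (u + n) * ε) * (w * (w * 1ℚ)) ∣
        ≤⟨ ∣p*q∣≤ {q = w * (w * 1ℚ)} ∣n²Δ-n∣≤C (≤-reflexive (0≤p⇒∣p∣≡p 0≤w²)) ⟩
      C * (w * (w * 1ℚ))                              ∎
      where
      open ≤-Reasoning
      Δ u κ ε : ℚ
      Δ = y - x
      κ = k x y
      u = n - κ
      ε = f d x - f e y
      ∣u∣≤K : ∣ u ∣ ≤ K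
      ∣u∣≤K = ∣n-k∣≤K {x} {y} x∈I y∈I
      ∣uΔ∣≤K : ∣ u * Δ ∣ ≤ K * 1ℚ
      ∣uΔ∣≤K = ∣p*q∣≤ {u} {Δ} {K} {1ℚ} ∣u∣≤K (∣y-x∣≤1 {x} {y} x∈I y∈I)
      ∣1+uΔ∣≤1+K : ∣ 1ℚ + u * Δ ∣ ≤ 1ℚ + K * 1ℚ
      ∣1+uΔ∣≤1+K = ∣p+q∣≤ {1ℚ} {u * Δ} {1ℚ} {K * 1ℚ} ≤-refl ∣uΔ∣≤K
      ∣u+n∣≤L : ∣ u + n ∣ ≤ L
      ∣u+n∣≤L = ∣p+q∣≤ {u} {n} {K} {n} ∣u∣≤K (≤-reflexive (0≤p⇒∣p∣≡p 0≤n))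
      ∣[u+n]ε∣≤1 : ∣ (u + n) * ε ∣ ≤ 1ℚ
      ∣[u+n]ε∣≤1 = ≤-trans (∣p*q∣≤ {u + n} {ε} {L} ∣u+n∣≤L (∣p-q∣≤∣p∣+∣q∣ (f d x) (f e y))) small
      ∣n²Δ-n∣≤C : ∣ u * (1ℚ + u * Δ) + (u + n) * ε ∣ ≤ C
      ∣n²Δ-n∣≤C = ∣p+q∣≤ {u * (1ℚ + u * Δ)} {(u + n) * ε} {K * (1ℚ + K * 1ℚ)} {1ℚ}
        (∣p*q∣≤ {u} {1ℚ + u * Δ} {K} {1ℚ + K * 1ℚ} ∣u∣≤K ∣1+uΔ∣≤1+K) ∣[u+n]ε∣≤1
      0≤w² : 0ℚ ≤ w * (w * 1ℚ)
      0≤w² = 0≤p*q 0≤w (0≤p*q 0≤w 0≤1)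
      ε≡ : ε ≡ Δ * κ - 1ℚ
      ε≡ = trans (f-secant d e x y) (trans (cong (λ e → Δ * κ + (d - e)) e≡d+1)
        (solve 2 (λ p d → p :+ (d :- (d :+ con 1ℚ)) := p :- con 1ℚ) refl (Δ * κ) d))
      Δ-w : Δ - w ≡ (u * (1ℚ + u * Δ) + (u + n) * ε) * (w * (w * 1ℚ))
      Δ-w = begin-equality
        -- The factors 1 are inserted in order to be replaced by n w, which brings out the common
        -- factor w².
        Δ - w                                    ≡⟨ solve 2 (λ Δ w → Δ :- w := con 1ℚ :* con 1ℚ :* Δ :- con 1ℚ :* w) refl Δ w ⟩
        1ℚ * 1ℚ * Δ - 1ℚ * w                     ≡⟨ cong (λ p → p * p * Δ - p * w) nw≡1 ⟨
        (n * w) * (n * w) * Δ - (n * w) * w      ≡⟨ solve 4 (λ n w Δ κ →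
                                                      (n :* w) :* (n :* w) :* Δ :- (n :* w) :* w :=
                                                      ((n :- κ) :* (con 1ℚ :+ (n :- κ) :* Δ) :+ (n :- κ :+ n) :* (Δ :* κ :- con 1ℚ))
                                                        :* (w :* (w :* con 1ℚ))) refl n w Δ κ ⟩
        (u * (1ℚ + u * Δ) + (u + n) * (Δ * κ - 1ℚ)) * (w * (w * 1ℚ))
                                                 ≡⟨ cong (λ p → (u * (1ℚ + u * Δ) + (u + n) * p) * (w * (w * 1ℚ))) ε≡ ⟨
        (u * (1ℚ + u * Δ) + (u + n) * ε) * (w * (w * 1ℚ)) ∎

open Rationals

open import Defs
open import Data.Fin.Base as Fin using (Fin; toℕ; fromℕ<)
open import Data.Fin.Properties using (toℕ<n; toℕ-fromℕ<)
open import Data.Integer.Base as ℤ using (-[1+_]; 1ℤ)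
import Data.Integer.Properties as ℤ
open import Data.Integer.Solver using (module +-*-Solver)
open import Data.Nat.Base as ℕ using (ℕ; suc; _⊔_)
import Data.Nat.Properties as ℕ
open import Data.Product.Base using (∃-syntax; _×_; _,_; proj₁; proj₂)
open import Data.Rational.Base as ℚ using (ℚ; 0ℚ; 1ℚ; ½)
import Data.Rational.Properties as ℚ
open import Level using (0ℓ)
open import Relation.Binary.PropositionalEquality using (_≡_; refl; sym; trans; cong; subst)
open import Relation.Unary using (Pred)

-- Eventual properties of sequences.

always : {P : Pred ℕ 0ℓ} → (∀ n → P n) → Eventually P
always p = 0 , λ n _ → p n

infixl 4 _⊛_

_⊛_ : {P Q : Pred ℕ 0ℓ} → Eventually (λ n → P n → Q n) → Eventually P → Eventually Q
(M₁ , f) ⊛ (M₂ , p) = M₁ ⊔ M₂ , λ n M≤n →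
  f n (ℕ.m⊔n≤o⇒m≤o M₁ M₂ M≤n) (p n (ℕ.m⊔n≤o⇒n≤o M₁ M₂ M≤n))

0<¼ε : ∀ {ε} → 0ℚ ℚ.< ε → 0ℚ ℚ.< ¼ ℚ.* ε
0<¼ε {ε} 0<ε = subst (ℚ._< ¼ ℚ.* ε) (ℚ.*-zeroʳ ¼) (ℚ.*-monoʳ-<-pos ¼ 0<ε)

p<p+q : ∀ p {q} → 0ℚ ℚ.< q → p ℚ.< p ℚ.+ q
p<p+q p {q} 0<q = subst (ℚ._< p ℚ.+ q) (ℚ.+-identityʳ p) (ℚ.+-monoʳ-< p 0<q)

-- The roots as real numbers, for fixed `b` and `N`.

module Family (b : ℤ) (N : ℕ) .{{_ : ℕ.NonZero N}} where

  c : ℤ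
  c = ℤ.- b ℤ.- + 2 ℤ.- + N

  c-eq : c ℚ./ 1 ≡ ℚ.- (b ℚ./ 1) ℚ.- 2ℚ ℚ.- (+ N ℚ./ 1)
  c-eq = trans (/1-homo-- (ℤ.- b ℤ.- + 2) (+ N)) (cong (ℚ._- (+ N ℚ./ 1))
    (trans (/1-homo-- (ℤ.- b) (+ 2)) (cong (ℚ._- 2ℚ) (/1-homo-neg b))))

  -b-c-2≡N : ℤ.- b ℤ.- c ℤ.- + 2 ≡ + N
  -b-c-2≡N = solve 2 (λ b n → :- b :- (:- b :- con (+ 2) :- n) :- con (+ 2) := n) refl b (+ N)
    where open +-*-Solver

  open Cubic (b ℚ./ 1) (c ℚ./ 1) (+ N ℚ./ 1) c-eq (/1-mono-≤ {1ℤ} {+ N} (ℤ.+≤+ (ℕ.>-nonZero⁻¹ N))) public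

  n : ℚ
  n = + N ℚ./ 1

  -- `Fin` counts from 0, the admissible constant terms from 1.
  d : Fin N → ℚ
  d i = + suc (toℕ i) ℚ./ 1

  1≤d : ∀ i → 1ℚ ℚ.≤ d i
  1≤d i = /1-mono-≤ {1ℤ} {+ suc (toℕ i)} (ℤ.+≤+ (ℕ.s≤s ℕ.z≤n))

  0≤d : ∀ i → 0ℚ ℚ.≤ d i
  0≤d i = ℚ.≤-trans 0≤1 (1≤d i)

  d≤n : ∀ i → d i ℚ.≤ n
  d≤n i = /1-mono-≤ {+ suc (toℕ i)} {+ N} (ℤ.+≤+ (toℕ<n i))

  1+d : ∀ i → + suc (suc (toℕ i)) ℚ./ 1 ≡ d i ℚ.+ 1ℚ
  1+d i = trans (/1-homo-+ 1ℤ (+ suc (toℕ i))) (ℚ.+-comm 1ℚ (d i))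

  abstract

    X : Fin N → ℕ → ℚ
    X i m = proj₁ (approximateRoot (0≤d i) (d≤n i) m)

    X∈I : ∀ i m → InUnit (X i m)
    X∈I i m = proj₁ (proj₂ (approximateRoot (0≤d i) (d≤n i) m))

    ∣fX∣≤ : ∀ i m → ℚ.∣ f (d i) (X i m) ∣ ℚ.≤ L ℚ.* mesh m
    ∣fX∣≤ i m = proj₂ (proj₂ (approximateRoot (0≤d i) (d≤n i) m))

  fX-vanishes : ∀ i ε → 0ℚ ℚ.< ε → Eventually λ m → ℚ.∣ f (d i) (X i m) ∣ ℚ.< ε
  fX-vanishes i ε 0<ε = let M , bound = mesh-vanishes L ε 0<ε in
    M , λ m M≤m → ℚ.≤-<-trans (∣fX∣≤ i m) (bound m M≤m)

  fX≤½ : ∀ i → Eventually λ m → ℚ.∣ f (d i) (X i m) ∣ ℚ.≤ ½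
  fX≤½ i = always (λ m → ℚ.<⇒≤) ⊛ fX-vanishes i ½ (ℚ.positive⁻¹ ½)

  fX≤¼ : ∀ i → Eventually λ m → ℚ.∣ f (d i) (X i m) ∣ ℚ.≤ ¼
  fX≤¼ i = always (λ m → ℚ.<⇒≤) ⊛ fX-vanishes i ¼ (ℚ.positive⁻¹ ¼)

  X-cauchy : ∀ i → IsCauchy (X i)
  X-cauchy i ε 0<ε = let M₁ , small = fX≤½ i
                         M₂ , tiny = fX-vanishes i (¼ ℚ.* ε) (0<¼ε 0<ε) in
    M₁ ⊔ M₂ , λ m n M≤m M≤n →
    rootDistance {d i} {X i m} {X i n} (1≤d i) (d≤n i) (X∈I i m) (X∈I i n)
      (small m (ℕ.m⊔n≤o⇒m≤o M₁ M₂ M≤m))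
      (tiny m (ℕ.m⊔n≤o⇒n≤o M₁ M₂ M≤m)) (tiny n (ℕ.m⊔n≤o⇒n≤o M₁ M₂ M≤n))

  root : Fin N → ℝ
  root i = mkℝ (X i) (X-cauchy i)

  -- A single η serves every strict inequality between roots, and between roots and the ends 0 and
  -- 1.
  margin : ∃[ η ] 0ℚ ℚ.< η × L ℚ.* η ℚ.< ½
  margin = let M , bound = mesh-vanishes L ½ (ℚ.positive⁻¹ ½) in
    mesh M , 0<mesh M , bound M ℕ.≤-refl

  ∣exactRoot∣≤¼ : ∀ {e y} → f e y ≡ 0ℚ → ℚ.∣ f e y ∣ ℚ.≤ ¼
  ∣exactRoot∣≤¼ fey≡0 = subst (λ p → ℚ.∣ p ∣ ℚ.≤ ¼) (sym fey≡0) (ℚ.nonNegative⁻¹ ¼)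

  root>0 : ∀ i → 0ℝ < root i
  root>0 i = let η , 0<η , Lη<½ = margin in η , 0<η ,
    (always (λ m f≤½ f≤¼ → separation {0ℚ} {d i} {0ℚ} {X i m}
        (1≤d i) 0∈I (X∈I i m) (∣exactRoot∣≤¼ {0ℚ} {0ℚ} f-0-0) f≤¼
        -- `½≤k` expects the approximate root as first argument; here it is the second, so symmetry
        -- of the slope is used.
        (subst (½ ℚ.≤_) (slope-comm (b ℚ./ 1) n (X i m) 0ℚ)
          (½≤k {d i} {X i m} {0ℚ} (1≤d i) (d≤n i) (X∈I i m) f≤½ 0∈I))
        Lη<½)
      ⊛ fX≤½ i ⊛ fX≤¼ i)

  root<1 : ∀ i → root i < 1ℝ
  root<1 i = let η , 0<η , Lη<½ = margin in η , 0<η ,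
    (always (λ m f≤½ f≤¼ → separation {d i} {n ℚ.+ 1ℚ} {X i m} {1ℚ}
        (ℚ.+-monoˡ-≤ 1ℚ (d≤n i)) (X∈I i m) 1∈I f≤¼ (∣exactRoot∣≤¼ {n ℚ.+ 1ℚ} {1ℚ} f-n+1-1)
        (½≤k {d i} {X i m} {1ℚ} (1≤d i) (d≤n i) (X∈I i m) f≤½ 1∈I) Lη<½)
      ⊛ fX≤½ i ⊛ fX≤¼ i)

  root-increasing : ∀ i j → i Fin.< j → root i < root j
  root-increasing i j i<j = let η , 0<η , Lη<½ = margin in η , 0<η ,
    (always (λ m f≤½ f≤¼ g≤¼ → separation {d i} {d j} {X i m} {X j m}
        (subst (ℚ._≤ d j) (1+d i) (/1-mono-≤ {+ suc (suc (toℕ i))} {+ suc (toℕ j)} (ℤ.+≤+ (ℕ.s≤s i<j))))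
        (X∈I i m) (X∈I j m) f≤¼ g≤¼
        (½≤k {d i} {X i m} {X j m} (1≤d i) (d≤n i) (X∈I i m) f≤½ (X∈I j m)) Lη<½)
      ⊛ fX≤½ i ⊛ fX≤¼ i ⊛ fX≤¼ j)

  root-member : ∀ i → I³ᵗʳ-family b N (root i)
  root-member i = root>0 i , root<1 i , + suc (toℕ i)
    , ℤ.+≤+ (ℕ.s≤s ℕ.z≤n)
    , subst (+ suc (toℕ i) ℤ.≤_) (sym -b-c-2≡N) (ℤ.+≤+ (toℕ<n i))
    , λ ε 0<ε →
        -- The terms of the real polynomial are definitionally values of `cubic`, because its powers
        -- are written as `_^_` unfolds; only the subtraction of zero has to be removed.
        always (λ m → subst (λ p → ℚ.∣ p ∣ ℚ.< ε) (sym (ℚ.+-identityʳ (f (d i) (X i m)))))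
          ⊛ fX-vanishes i ε 0<ε

  index : ∀ z → 1ℤ ℤ.≤ z → z ℤ.≤ ℤ.- b ℤ.- c ℤ.- + 2 → ∃[ i ] z ℚ./ 1 ≡ d i
  index (+ suc k) _ z≤ = fromℕ< k<N , cong (λ k → + suc k ℚ./ 1) (sym (toℕ-fromℕ< k<N))
    where
    k<N : k ℕ.< N
    k<N = ℤ.drop‿+≤+ (subst (+ suc k ℤ.≤_) -b-c-2≡N z≤)
  index (+ 0) (ℤ.+≤+ ()) _
  index -[1+ _ ] () _

  -- Early terms of `α` may lie outside [0,1]; the margins in the two strict inequalities keep all
  -- later ones inside.
  in-unit : ∀ {α} → 0ℝ < α → α < 1ℝ → Eventually λ m → InUnit (seq α m)
  in-unit {α} (ε , 0<ε , 0<α) (ε′ , 0<ε′ , α<1) =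
    always (λ m 0<α α<1 →
        ℚ.<⇒≤ (ℚ.≤-<-trans (0≤p+q ℚ.≤-refl (ℚ.<⇒≤ 0<ε)) 0<α)
      , ℚ.<⇒≤ (ℚ.≤-<-trans (ℚ.<⇒≤ (p<p+q (seq α m) 0<ε′)) α<1))
      ⊛ 0<α ⊛ α<1

  -- The terms of `α` are eventually approximate roots for an admissible constant term, so
  -- `rootDistance` compares them with `X i m`.
  root-exhaustive : ∀ α → I³ᵗʳ-family b N α → ∃[ i ] α ≈ root i
  root-exhaustive α (0<α , α<1 , z , 1≤z , z≤ , fα≈0) = i , λ ε 0<ε →
    always (λ m α∈I f≤½ fα fX →
        rootDistance {d i} {seq α m} {X i m} (1≤d i) (d≤n i) α∈I (X∈I i m) (ℚ.<⇒≤ f≤½) fα fX)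
      ⊛ in-unit {α} 0<α α<1 ⊛ fα-vanishes ½ (ℚ.positive⁻¹ ½)
      ⊛ fα-vanishes (¼ ℚ.* ε) (0<¼ε 0<ε) ⊛ fX-vanishes i (¼ ℚ.* ε) (0<¼ε 0<ε)
    where
    i : Fin N
    i = proj₁ (index z 1≤z z≤)
    z≡d : z ℚ./ 1 ≡ d i
    z≡d = proj₂ (index z 1≤z z≤)
    fα-vanishes : ∀ ε → 0ℚ ℚ.< ε → Eventually λ m → ℚ.∣ f (d i) (seq α m) ∣ ℚ.< ε
    fα-vanishes ε 0<ε = always (λ m → subst (λ p → ℚ.∣ p ∣ ℚ.< ε)
      (trans (ℚ.+-identityʳ (f (z ℚ./ 1) (seq α m))) (cong (λ d → f d (seq α m)) z≡d))) ⊛ fα≈0 ε 0<ε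

  -- `gap` gives the bound for the approximations themselves as soon as 2 L² `mesh m` is below 1, so
  -- no limit of inequalities is needed.
  root-gap : GapBound (fromℚ (gapConstant (b ℚ./ 1))) N root
  root-gap i j j≡1+i ε 0<ε =
    always (λ m tiny → ℚ.≤-<-trans
        (gap {d i} {d j} {X i m} {X j m} (trans (cong (λ k → + suc k ℚ./ 1) j≡1+i) (1+d i))
          (X∈I i m) (X∈I j m) (0≤1/n N) (n/1*1/n N)
          (ℚ.≤-trans
            (ℚ.*-monoˡ-≤-nonNeg L {{ℚ.nonNegative 0≤L}} (ℚ.+-mono-≤ (∣fX∣≤ i m) (∣fX∣≤ j m)))
            (ℚ.≤-trans (ℚ.≤-reflexive (regroup m)) (ℚ.<⇒≤ tiny))))
        (p<p+q _ 0<ε))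
      ⊛ mesh-vanishes (L ℚ.* (L ℚ.+ L)) 1ℚ (ℚ.positive⁻¹ 1ℚ)
    where
    regroup : ∀ m → L ℚ.* (L ℚ.* mesh m ℚ.+ L ℚ.* mesh m) ≡ L ℚ.* (L ℚ.+ L) ℚ.* mesh m
    regroup m = trans (cong (L ℚ.*_) (sym (ℚ.*-distribʳ-+ (mesh m) L L))) (sym (ℚ.*-assoc L (L ℚ.+ L) (mesh m)))

  isIncreasingEnumeration : IsIncreasingEnumeration (I³ᵗʳ-family b N) root
  isIncreasingEnumeration = record
    { member     = root-member
    ; increasing = root-increasing
    ; exhaustive = root-exhaustive
    }

<⇒≤ : ∀ {x y} → x < y → x ≤ y
<⇒≤ {x} {y} (η , 0<η , x<y) ε 0<ε = always (λ m x+η<y →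
    ℚ.<-trans (ℚ.<-trans (p<p+q (seq x m) 0<η) x+η<y) (p<p+q (seq y m) 0<ε))
  ⊛ x<y

theorem13 : (b : ℤ) → AlmostUniformForLargeN (I³ᵗʳ-family b)
theorem13 b = record
  { inUnitInterval = λ _ α (0<α , α<1 , _) → <⇒≤ {0ℝ} {α} 0<α , <⇒≤ {α} {1ℝ} α<1
  -- The constant is fixed before N is introduced.
  ; almostUniform  = fromℚ (gapConstant (b ℚ./ 1)) , λ N →
      let open Family b N in root , isIncreasingEnumeration , root-gap
  }
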